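{- For a graph $G$ without isolated vertices, the following are equivalent: (1) $G$ is very well-covered; (2) $G$ has a perfect matching every edge of which (as a $2$-vertex set) is a strong clique; (3) $G$ has a perfect matching, and every edge of every perfect matching of $G$ is a strong clique; (4) $V(G)$ admits a partition into strong cliques of size two. In particular, every very well-covered graph is localizable.
   Context: A clique is strong if it intersects every maximal independent set. A graph is localizable if its vertex set admits a partition into strong cliques. A graph is well-covered if all its maximal independent sets have the same size; it is very well-covered if it is well-covered, has no isolated vertices, and $\alpha(G)=|V(G)|/2$, where $\alpha(G)$ is the independence number. -}

module Defs where

open import Level using (0ℓ)
open import Data.Nat using (ℕ; zero; suc; _*_; _≤_; s≤s⁻¹; _≟_)
open import Data.Nat.Properties using (≤∧≢⇒<)
open import Data.Fin using (Fin)
open import Data.Fin.Properties using (all?)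
open import Data.Fin.Subset using (Subset; _∈_; _⊆_; _∩_; _∪_; ⁅_⁆; ∣_∣; Nonempty; ⊥)
open import Data.Fin.Subset.Properties using (_∈?_; ∉⊥; ∣⊥∣≡0; ∣p∣≤n; anySubset?)
open import Data.Empty using (⊥-elim)
open import Data.Product using (∃; _×_; _,_; proj₁)
open import Relation.Binary using (Rel; Symmetric; Irreflexive; Decidable)
open import Relation.Binary.PropositionalEquality using (_≡_; _≢_)
open import Relation.Nullary using (¬_; Dec; yes; no; ¬?; _×-dec_; _→-dec_)
open import Relation.Unary using (Pred)

-- Finite simple graphs on the vertex set Fin n.
record Graph (n : ℕ) : Set₁ where
  field
    Adj    : Rel (Fin n) 0ℓ
    sym    : Symmetric Adj
    irrefl : Irreflexive _≡_ Adj
    adj?   : Decidable Adj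

module _ {n : ℕ} (G : Graph n) where
  open Graph G

  NoIsolatedVertices : Set
  NoIsolatedVertices = ∀ v → ∃ λ u → Adj v u

  Independent : Subset n → Set
  Independent S = ∀ u v → u ∈ S → v ∈ S → ¬ Adj u v

  -- Maximal with respect to inclusion.
  MaximalIndependent : Subset n → Set
  MaximalIndependent S =
    Independent S × (∀ T → Independent T → S ⊆ T → T ⊆ S)

  Clique : Subset n → Set
  Clique C = ∀ u v → u ∈ C → v ∈ C → u ≢ v → Adj u v

  StrongClique : Subset n → Set
  StrongClique C = Clique C × (∀ S → MaximalIndependent S → Nonempty (C ∩ S))

  independent? : ∀ S → Dec (Independent S)
  independent? S = all? λ u → all? λ v →
    (u ∈? S) →-dec ((v ∈? S) →-dec ¬? (adj? u v))

  IsIndependenceNumber : ℕ → Set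
  IsIndependenceNumber a =
    (∃ λ S → Independent S × ∣ S ∣ ≡ a) × (∀ S → Independent S → ∣ S ∣ ≤ a)

  independenceNumber-exists : ∃ IsIndependenceNumber
  independenceNumber-exists = search n (λ S _ → ∣p∣≤n S)
    where
    search : ∀ k → (∀ S → Independent S → ∣ S ∣ ≤ k) → ∃ IsIndependenceNumber
    search zero    ub = zero , (⊥ , (λ _ _ u∈⊥ → ⊥-elim (∉⊥ u∈⊥)) , ∣⊥∣≡0 n) , ub
    search (suc k) ub with anySubset? (λ S → independent? S ×-dec (∣ S ∣ ≟ suc k))
    ... | yes attained = suc k , attained , ub
    ... | no  missed   = search k λ S ind →
      s≤s⁻¹ (≤∧≢⇒< (ub S ind) (λ eq → missed (S , ind , eq)))

  α : ℕ
  α = proj₁ independenceNumber-exists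

  WellCovered : Set
  WellCovered = ∀ S T → MaximalIndependent S → MaximalIndependent T → ∣ S ∣ ≡ ∣ T ∣

  -- α(G) = |V(G)| / 2 is an exact equation (not integer division), hence 2 * α ≡ n.
  VeryWellCovered : Set
  VeryWellCovered = WellCovered × NoIsolatedVertices × 2 * α ≡ n

  Edge : Subset n → Set
  Edge e = ∃ λ u → ∃ λ v → Adj u v × e ≡ ⁅ u ⁆ ∪ ⁅ v ⁆

  -- Families of vertex sets are arbitrary predicates on Subset n; a family
  -- satisfying either record below automatically has decidable membership.
  record PerfectMatching (M : Pred (Subset n) 0ℓ) : Set where
    field
      edges    : ∀ e → M e → Edge e
      disjoint : ∀ e f → M e → M f → ∀ v → v ∈ e → v ∈ f → e ≡ f
      covers   : ∀ v → ∃ λ e → M e × v ∈ e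

record Partition {n : ℕ} (P : Pred (Subset n) 0ℓ) : Set where
  field
    nonempty : ∀ C → P C → Nonempty C
    disjoint : ∀ C D → P C → P D → ∀ v → v ∈ C → v ∈ D → C ≡ D
    covers   : ∀ v → ∃ λ C → P C × v ∈ C

Localizable : ∀ {n} → Graph n → Set₁
Localizable {n} G =
  ∃ λ (P : Pred (Subset n) 0ℓ) → Partition P × (∀ C → P C → StrongClique G C)

HasStrongPerfectMatching : ∀ {n} → Graph n → Set₁
HasStrongPerfectMatching {n} G =
  ∃ λ (M : Pred (Subset n) 0ℓ) →
    PerfectMatching G M × (∀ e → M e → StrongClique G e)

HasPerfectMatchingAndAllStrong : ∀ {n} → Graph n → Set₁
HasPerfectMatchingAndAllStrong {n} G =
  (∃ λ (M : Pred (Subset n) 0ℓ) → PerfectMatching G M) ×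
  (∀ (M : Pred (Subset n) 0ℓ) → PerfectMatching G M → ∀ e → M e → StrongClique G e)

HasStrongPairPartition : ∀ {n} → Graph n → Set₁
HasStrongPairPartition {n} G =
  ∃ λ (P : Pred (Subset n) 0ℓ) →
    Partition P × (∀ C → P C → StrongClique G C × ∣ C ∣ ≡ 2)

{-# OPTIONS --safe #-}
-- The only hard implication is (1) ⇒ (3), and there the existence of a perfect
-- matching.  In a well-covered graph without isolated vertices every
-- independent set A satisfies |A| ≤ |N(A)| (Berge): take B maximal independent
-- in N(A) and a maximal independent I ⊇ B.  Then (I ─ B) ∪ (A ∩ N(B)) is
-- independent, hence not larger than I, so |A ∩ N(B)| ≤ |B|; the rest A ─ N(B)
-- has all its neighbours in N(A) ─ B, and one concludes by induction.  Hall's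
-- theorem then matches a maximal independent set S into its complement, and
-- |S| = n / 2 makes the matching perfect.  Everything else is counting:
-- a perfect matching maps every maximal independent set S injectively into ∁ S,
-- and these maps are all onto exactly when all its edges are strong.
module Submission where

open import Defs
open import Data.Nat using (ℕ; suc; _+_; _*_; _≤_; _<_; z≤n; s≤s; s≤s⁻¹; _<?_)
open import Data.Nat.Properties using
  (≤-trans; ≤-reflexive; ≤-antisym; +-comm; +-suc; +-identityʳ; +-mono-≤; +-monoʳ-≤;
   +-cancelˡ-≡; +-cancelˡ-≤; *-cancelˡ-≡; m≤m+n; m+[n∸m]≡n; ≮⇒≥; <⇒≱; ≤-<-trans;
   module ≤-Reasoning)
open import Data.Fin using (Fin; zero; suc; _≟_)
open import Data.Fin.Properties using (any?; suc-injective; 0≢1+n)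
open import Data.Fin.Subset using
  (Subset; inside; outside; _∈_; _∉_; _⊆_; _⊂_; _⊃_; _∩_; _∪_; _─_; _-_; ∁; ⁅_⁆; ∣_∣;
   Nonempty; Empty; ⊥; ⊤)
open import Data.Fin.Subset.Properties using
  (_∈?_; _⊆?_; ∉⊥; ∣⊥∣≡0; ∈⊤; ∣p∣≤n; anySubset?; nonempty?; Empty-unique; x∈⁅x⁆;
   x∈⁅y⁆⇒x≡y; ∣⁅x⁆∣≡1; ⊆-antisym; p⊆q⇒∣p∣≤∣q∣; p⊂q⇒∣p∣<∣q∣; x∈∁p⇒x∉p; x∉p⇒x∈∁p;
   ∣∁p∣≡n∸∣p∣; x∈p∩q⁺; x∈p∩q⁻; ∪-comm; p⊆p∪q; q⊆p∪q; x∈p∪q⁺; x∈p∪q⁻; x∈p∧x∉q⇒x∈p─q;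
   p─q⊆p; p∩q≢∅⇒p─q⊂p; x∈p∧x≢y⇒x∈p-y; x∈p⇒p-x⊂p; x∈p⇒∣p-x∣<∣p∣)
open import Data.Fin.Subset.Induction using (⊂-wellFounded; ⊃-wellFounded; Acc; acc)
open import Data.List using (List; []; _∷_; allFin)
open import Data.List.Membership.Propositional using () renaming (_∈_ to _∈ˡ_)
open import Data.List.Membership.Propositional.Properties using (∈-allFin)
open import Data.List.Relation.Unary.Any using (here; there)
open import Data.Product using (∃; _×_; _,_; proj₁; proj₂)
open import Data.Sum using (_⊎_; inj₁; inj₂; [_,_]′)
open import Data.Vec using ([]; _∷_; here; there; tabulate)
open import Data.Vec.Properties using (lookup∘tabulate; lookup⇒[]=; []=⇒lookup)
open import Data.Vec.Functional using (updateAt)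
open import Data.Vec.Functional.Properties using (updateAt-updates; updateAt-minimal)
open import Function using (_∘_; const; id)
open import Function.Bundles using (_⇔_; mk⇔)
open import Level using (0ℓ)
open import Relation.Binary.PropositionalEquality using
  (_≡_; _≢_; refl; sym; trans; cong; cong₂; subst; subst₂)
open import Relation.Nullary using (¬_; yes; no; does; ¬?; contradiction; _×-dec_)
open import Relation.Nullary.Decidable using (dec-true)
open import Relation.Unary using (Pred; Decidable)

private variable
  m n : ℕ

-- Finite subsets

comprehension : {P : Pred (Fin n) 0ℓ} → Decidable P → Subset n
comprehension P? = tabulate (does ∘ P?)

module _ {P : Pred (Fin n) 0ℓ} (P? : Decidable P) where

  ∈-comprehension⁺ : ∀ {x} → P x → x ∈ comprehension P?
  ∈-comprehension⁺ {x} px =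
    lookup⇒[]= x _ (trans (lookup∘tabulate _ x) (dec-true (P? x) px))

  ∈-comprehension⁻ : ∀ {x} → x ∈ comprehension P? → P x
  ∈-comprehension⁻ {x} x∈ with P? x in eq
  ... | yes px = px
  ... | no _ = contradiction
    (trans (sym ([]=⇒lookup x∈)) (trans (lookup∘tabulate _ x) (cong does eq))) λ ()

x∈p─q⇒x∉q : ∀ (p q : Subset n) {x} → x ∈ p ─ q → x ∉ q
x∈p─q⇒x∉q (_ ∷ p) (outside ∷ q) (there x∈) (there x∈q) = x∈p─q⇒x∉q p q x∈ x∈q
x∈p─q⇒x∉q (_ ∷ p) (inside ∷ q) (there x∈) (there x∈q) = x∈p─q⇒x∉q p q x∈ x∈q

∣p∪q∣+∣p∩q∣≡∣p∣+∣q∣ : ∀ (p q : Subset n) → ∣ p ∪ q ∣ + ∣ p ∩ q ∣ ≡ ∣ p ∣ + ∣ q ∣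
∣p∪q∣+∣p∩q∣≡∣p∣+∣q∣ [] [] = refl
∣p∪q∣+∣p∩q∣≡∣p∣+∣q∣ (outside ∷ p) (outside ∷ q) = ∣p∪q∣+∣p∩q∣≡∣p∣+∣q∣ p q
∣p∪q∣+∣p∩q∣≡∣p∣+∣q∣ (inside ∷ p) (outside ∷ q) = cong suc (∣p∪q∣+∣p∩q∣≡∣p∣+∣q∣ p q)
∣p∪q∣+∣p∩q∣≡∣p∣+∣q∣ (outside ∷ p) (inside ∷ q) =
  trans (cong suc (∣p∪q∣+∣p∩q∣≡∣p∣+∣q∣ p q)) (sym (+-suc ∣ p ∣ ∣ q ∣))
∣p∪q∣+∣p∩q∣≡∣p∣+∣q∣ (inside ∷ p) (inside ∷ q) = cong suc
  (trans (+-suc ∣ p ∪ q ∣ ∣ p ∩ q ∣)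
    (trans (cong suc (∣p∪q∣+∣p∩q∣≡∣p∣+∣q∣ p q)) (sym (+-suc ∣ p ∣ ∣ q ∣))))

∣p∪q∣≤∣p∣+∣q∣ : ∀ (p q : Subset n) → ∣ p ∪ q ∣ ≤ ∣ p ∣ + ∣ q ∣
∣p∪q∣≤∣p∣+∣q∣ p q = ≤-trans (m≤m+n _ _) (≤-reflexive (∣p∪q∣+∣p∩q∣≡∣p∣+∣q∣ p q))

disjoint⇒∣p∪q∣≡∣p∣+∣q∣ : ∀ (p q : Subset n) → (∀ {x} → x ∈ p → x ∉ q) →
  ∣ p ∪ q ∣ ≡ ∣ p ∣ + ∣ q ∣
disjoint⇒∣p∪q∣≡∣p∣+∣q∣ {n} p q disj =
  trans (sym (+-identityʳ _))
    (trans (cong (∣ p ∪ q ∣ +_) (sym ∣p∩q∣≡0)) (∣p∪q∣+∣p∩q∣≡∣p∣+∣q∣ p q))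
  where
  p∩q-empty : Empty (p ∩ q)
  p∩q-empty (x , x∈) = let x∈p , x∈q = x∈p∩q⁻ p q x∈ in disj x∈p x∈q
  ∣p∩q∣≡0 : ∣ p ∩ q ∣ ≡ 0
  ∣p∩q∣≡0 = trans (cong ∣_∣ (Empty-unique p∩q-empty)) (∣⊥∣≡0 n)

∣p∣+∣∁p∣≡n : ∀ (p : Subset n) → ∣ p ∣ + ∣ ∁ p ∣ ≡ n
∣p∣+∣∁p∣≡n p = trans (cong (∣ p ∣ +_) (∣∁p∣≡n∸∣p∣ p)) (m+[n∸m]≡n (∣p∣≤n p))

p⊆q∪[p─q] : ∀ (p q : Subset n) → p ⊆ q ∪ (p ─ q)
p⊆q∪[p─q] p q {x} x∈p with x ∈? q
... | yes x∈q = x∈p∪q⁺ (inj₁ x∈q)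
... | no x∉q = x∈p∪q⁺ (inj₂ (x∈p∧x∉q⇒x∈p─q x∈p x∉q))

∣p∣≤∣q∣+∣p─q∣ : ∀ (p q : Subset n) → ∣ p ∣ ≤ ∣ q ∣ + ∣ p ─ q ∣
∣p∣≤∣q∣+∣p─q∣ p q = ≤-trans (p⊆q⇒∣p∣≤∣q∣ (p⊆q∪[p─q] p q)) (∣p∪q∣≤∣p∣+∣q∣ q (p ─ q))

∣p∣≤∣p∩q∣+∣p─q∣ : ∀ (p q : Subset n) → ∣ p ∣ ≤ ∣ p ∩ q ∣ + ∣ p ─ q ∣
∣p∣≤∣p∩q∣+∣p─q∣ p q = ≤-trans (p⊆q⇒∣p∣≤∣q∣ p⊆) (∣p∪q∣≤∣p∣+∣q∣ (p ∩ q) (p ─ q))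
  where
  p⊆ : p ⊆ (p ∩ q) ∪ (p ─ q)
  p⊆ x∈p with x∈p∪q⁻ q _ (p⊆q∪[p─q] p q x∈p)
  ... | inj₁ x∈q = x∈p∪q⁺ (inj₁ (x∈p∩q⁺ (x∈p , x∈q)))
  ... | inj₂ x∈ = x∈p∪q⁺ (inj₂ x∈)

∣p∣≤1+∣p-x∣ : ∀ (p : Subset n) x → ∣ p ∣ ≤ suc ∣ p - x ∣
∣p∣≤1+∣p-x∣ p x =
  subst (λ k → ∣ p ∣ ≤ k + ∣ p - x ∣) (∣⁅x⁆∣≡1 x) (∣p∣≤∣q∣+∣p─q∣ p ⁅ x ⁆)

⁅⁆⊆ : ∀ {x} {p : Subset n} → x ∈ p → ⁅ x ⁆ ⊆ p
⁅⁆⊆ {p = p} x∈p y∈ = subst (_∈ p) (sym (x∈⁅y⁆⇒x≡y _ y∈)) x∈p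

∣p∣>0⇒Nonempty : ∀ (p : Subset n) → 0 < ∣ p ∣ → Nonempty p
∣p∣>0⇒Nonempty {n} p 0<∣p∣ with nonempty? p
... | yes ne = ne
... | no ¬ne with subst (λ q → 0 < ∣ q ∣) (Empty-unique ¬ne) 0<∣p∣
... | 0<∣⊥∣ = contradiction (subst (0 <_) (∣⊥∣≡0 n) 0<∣⊥∣) λ ()

p⊆q∧∣q∣≤∣p∣⇒q⊆p : ∀ {p q : Subset n} → p ⊆ q → ∣ q ∣ ≤ ∣ p ∣ → q ⊆ p
p⊆q∧∣q∣≤∣p∣⇒q⊆p {p = p} p⊆q ∣q∣≤∣p∣ {x} x∈q with x ∈? p
... | yes x∈p = x∈p
... | no x∉p = contradiction ∣q∣≤∣p∣ (<⇒≱ (p⊂q⇒∣p∣<∣q∣ (p⊆q , x , x∈q , x∉p)))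

-- Two-element subsets

⁅_&_⁆ : Fin n → Fin n → Subset n
⁅ u & v ⁆ = ⁅ u ⁆ ∪ ⁅ v ⁆

x∈⁅x&y⁆ : ∀ (x y : Fin n) → x ∈ ⁅ x & y ⁆
x∈⁅x&y⁆ x y = p⊆p∪q _ (x∈⁅x⁆ x)

y∈⁅x&y⁆ : ∀ (x y : Fin n) → y ∈ ⁅ x & y ⁆
y∈⁅x&y⁆ x y = q⊆p∪q ⁅ x ⁆ ⁅ y ⁆ (x∈⁅x⁆ y)

x∈⁅y&z⁆⁻ : ∀ {x} (y z : Fin n) → x ∈ ⁅ y & z ⁆ → x ≡ y ⊎ x ≡ z
x∈⁅y&z⁆⁻ y z x∈ with x∈p∪q⁻ ⁅ y ⁆ ⁅ z ⁆ x∈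
... | inj₁ x∈y = inj₁ (x∈⁅y⁆⇒x≡y y x∈y)
... | inj₂ x∈z = inj₂ (x∈⁅y⁆⇒x≡y z x∈z)

⁅x&y⁆⊆ : ∀ {x y} {p : Subset n} → x ∈ p → y ∈ p → ⁅ x & y ⁆ ⊆ p
⁅x&y⁆⊆ x∈p y∈p z∈ = [ ⁅⁆⊆ x∈p , ⁅⁆⊆ y∈p ]′ (x∈p∪q⁻ _ _ z∈)

∣⁅x&y⁆∣≡2 : ∀ {x y : Fin n} → x ≢ y → ∣ ⁅ x & y ⁆ ∣ ≡ 2
∣⁅x&y⁆∣≡2 {x = x} {y} x≢y =
  trans (disjoint⇒∣p∪q∣≡∣p∣+∣q∣ ⁅ x ⁆ ⁅ y ⁆
          λ z∈x z∈y → x≢y (trans (sym (x∈⁅y⁆⇒x≡y x z∈x)) (x∈⁅y⁆⇒x≡y y z∈y)))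
    (cong₂ _+_ (∣⁅x⁆∣≡1 x) (∣⁅x⁆∣≡1 y))

∣p∣≡2⇒pair : ∀ (p : Subset n) → ∣ p ∣ ≡ 2 → ∃ λ x → ∃ λ y → x ≢ y × p ≡ ⁅ x & y ⁆
∣p∣≡2⇒pair p ∣p∣≡2 with ∣p∣>0⇒Nonempty p (subst (0 <_) (sym ∣p∣≡2) (s≤s z≤n))
... | x , x∈p with ∣p∣>0⇒Nonempty (p - x) (s≤s⁻¹ (≤-trans (≤-reflexive (sym ∣p∣≡2)) (∣p∣≤1+∣p-x∣ p x)))
... | y , y∈p-x = x , y , x≢y ,
  ⊆-antisym
    (p⊆q∧∣q∣≤∣p∣⇒q⊆p pair⊆p (≤-reflexive (trans ∣p∣≡2 (sym (∣⁅x&y⁆∣≡2 x≢y)))))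
    pair⊆p
  where
  x≢y : x ≢ y
  x≢y refl = x∈p─q⇒x∉q p ⁅ x ⁆ y∈p-x (x∈⁅x⁆ x)
  pair⊆p : ⁅ x & y ⁆ ⊆ p
  pair⊆p = ⁅x&y⁆⊆ x∈p (p─q⊆p p ⁅ x ⁆ y∈p-x)

-- Counting with injections

InjectiveOn : Subset m → (Fin m → Fin n) → Set
InjectiveOn p f = ∀ {x y} → x ∈ p → y ∈ p → f x ≡ f y → x ≡ y

-- Induction on the domain: when `zero` belongs to it, injectivity keeps the other members away from
-- `f zero`, so they map into the smaller set `q - f zero`.
injectiveOn⇒∣p∣≤∣q∣ : ∀ (p : Subset m) (q : Subset n) (f : Fin m → Fin n) →
  (∀ {x} → x ∈ p → f x ∈ q) → InjectiveOn p f → ∣ p ∣ ≤ ∣ q ∣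
injectiveOn⇒∣p∣≤∣q∣ [] q f maps inj = z≤n
injectiveOn⇒∣p∣≤∣q∣ (outside ∷ p) q f maps inj =
  injectiveOn⇒∣p∣≤∣q∣ p q (f ∘ suc) (maps ∘ there)
    λ x∈ y∈ eq → suc-injective (inj (there x∈) (there y∈) eq)
injectiveOn⇒∣p∣≤∣q∣ (inside ∷ p) q f maps inj =
  ≤-<-trans
    (injectiveOn⇒∣p∣≤∣q∣ p (q - f zero) (f ∘ suc)
      (λ x∈ → x∈p∧x≢y⇒x∈p-y (maps (there x∈))
        λ eq → contradiction (inj here (there x∈) (sym eq)) 0≢1+n)
      λ x∈ y∈ eq → suc-injective (inj (there x∈) (there y∈) eq))
    (x∈p⇒∣p-x∣<∣p∣ (maps here))

-- If `y` were missed, `f` would inject `p` into `q - y`, which is too small.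
injectiveOn⇒surjectiveOn : ∀ (p : Subset m) (q : Subset n) (f : Fin m → Fin n) →
  (∀ {x} → x ∈ p → f x ∈ q) → InjectiveOn p f → ∣ q ∣ ≤ ∣ p ∣ →
  ∀ {y} → y ∈ q → ∃ λ x → x ∈ p × f x ≡ y
injectiveOn⇒surjectiveOn p q f maps inj ∣q∣≤∣p∣ {y} y∈q
  with any? (λ x → (x ∈? p) ×-dec (f x ≟ y))
... | yes hit = hit
... | no missed = contradiction ∣q∣≤∣p∣ (<⇒≱ (≤-<-trans
  (injectiveOn⇒∣p∣≤∣q∣ p (q - y) f
    (λ x∈ → x∈p∧x≢y⇒x∈p-y (maps x∈) λ eq → missed (_ , x∈ , eq)) inj)
  (x∈p⇒∣p-x∣<∣p∣ y∈q)))

-- Hall's theorem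

image? : ∀ (F : Fin m → Subset n) (A : Subset m) →
  Decidable λ y → ∃ λ x → x ∈ A × y ∈ F x
image? F A y = any? λ x → (x ∈? A) ×-dec (y ∈? F x)

image : (Fin m → Subset n) → Subset m → Subset n
image F A = comprehension (image? F A)

module _ {F : Fin m → Subset n} {A : Subset m} where

  ∈-image⁺ : ∀ {x y} → x ∈ A → y ∈ F x → y ∈ image F A
  ∈-image⁺ x∈A y∈Fx = ∈-comprehension⁺ (image? F A) (_ , x∈A , y∈Fx)

  ∈-image⁻ : ∀ {y} → y ∈ image F A → ∃ λ x → x ∈ A × y ∈ F x
  ∈-image⁻ = ∈-comprehension⁻ (image? F A)

HallOn : Subset m → (Fin m → Subset n) → Set
HallOn S F = ∀ A → A ⊆ S → ∣ A ∣ ≤ ∣ image F A ∣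

module _ {S : Subset m} where

  -- Failure comes with an explicit violating set, which the submodularity argument of `hall-split`
  -- needs.
  hallOn? : ∀ (F : Fin m → Subset n) →
    HallOn S F ⊎ ∃ λ A → A ⊆ S × ∣ image F A ∣ < ∣ A ∣
  hallOn? F with anySubset? (λ A → (A ⊆? S) ×-dec (∣ image F A ∣ <? ∣ A ∣))
  ... | yes violation = inj₂ violation
  ... | no none = inj₁ λ A A⊆S → ≮⇒≥ λ lt → none (A , A⊆S , lt)

  hall⇒nonempty : {F : Fin m → Subset n} → HallOn S F → ∀ {x} → x ∈ S → Nonempty (F x)
  hall⇒nonempty {F = F} hall {x} x∈S
    with ∣p∣>0⇒Nonempty (image F ⁅ x ⁆)
           (≤-trans (≤-reflexive (sym (∣⁅x⁆∣≡1 x))) (hall ⁅ x ⁆ (⁅⁆⊆ x∈S)))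
  ... | y , y∈ with ∈-image⁻ {F = F} y∈
  ... | z , z∈ , y∈Fz = y , subst (λ w → y ∈ F w) (x∈⁅y⁆⇒x≡y x z∈) y∈Fz

  -- Rado's argument: if both ways of shrinking F x violated Hall's condition, at
  -- A₁ and A₂, then F would violate it at A₁ ∪ A₂ or at (A₁ ∩ A₂) - x, because
  -- cardinality is submodular.
  hall-split : {F F₁ F₂ : Fin m → Subset n} {x : Fin m} →
    (∀ {z} → z ≢ x → F z ⊆ F₁ z) → (∀ {z} → z ≢ x → F z ⊆ F₂ z) →
    F x ⊆ F₁ x ∪ F₂ x → HallOn S F → HallOn S F₁ ⊎ HallOn S F₂
  hall-split {F = F} {F₁} {F₂} {x} F⊆F₁ F⊆F₂ Fx⊆ hall with hallOn? F₁ | hallOn? F₂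
  ... | inj₁ hall₁ | _ = inj₁ hall₁
  ... | inj₂ _ | inj₁ hall₂ = inj₂ hall₂
  ... | inj₂ (A₁ , A₁⊆S , lt₁) | inj₂ (A₂ , A₂⊆S , lt₂) = contradiction bound (<⇒≱ gap)
    where
    -- Away from `x` the family `F′` contains `F`, so a violator avoiding `x` would already violate
    -- Hall's condition for `F`.
    x∈violator : ∀ {F′} → (∀ {z} → z ≢ x → F z ⊆ F′ z) →
      ∀ {A} → A ⊆ S → ∣ image F′ A ∣ < ∣ A ∣ → x ∈ A
    x∈violator {F′} F⊆F′ {A} A⊆S lt with x ∈? A
    ... | yes x∈A = x∈A
    ... | no x∉A = contradiction
      (≤-trans (hall A A⊆S) (p⊆q⇒∣p∣≤∣q∣ image⊆)) (<⇒≱ lt)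
      where
      image⊆ : image F A ⊆ image F′ A
      image⊆ y∈ with ∈-image⁻ {F = F} y∈
      ... | z , z∈A , y∈Fz = ∈-image⁺ z∈A (F⊆F′ (λ { refl → x∉A z∈A }) y∈Fz)

    x∈A₁ : x ∈ A₁
    x∈A₁ = x∈violator F⊆F₁ A₁⊆S lt₁
    x∈A₂ : x ∈ A₂
    x∈A₂ = x∈violator F⊆F₂ A₂⊆S lt₂

    U₁ U₂ : Subset _
    U₁ = image F₁ A₁
    U₂ = image F₂ A₂

    union⊆ : image F (A₁ ∪ A₂) ⊆ U₁ ∪ U₂
    union⊆ y∈ with ∈-image⁻ {F = F} y∈
    ... | z , z∈ , y∈Fz with z ≟ x
    ... | yes refl = x∈p∪q⁺ ([ inj₁ ∘ ∈-image⁺ x∈A₁ , inj₂ ∘ ∈-image⁺ x∈A₂ ]′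
                              (x∈p∪q⁻ _ _ (Fx⊆ y∈Fz)))
    ... | no z≢x = x∈p∪q⁺ ([ (λ z∈A₁ → inj₁ (∈-image⁺ z∈A₁ (F⊆F₁ z≢x y∈Fz)))
                            , (λ z∈A₂ → inj₂ (∈-image⁺ z∈A₂ (F⊆F₂ z≢x y∈Fz))) ]′
                            (x∈p∪q⁻ _ _ z∈))

    -- `F x` is only covered by `F₁ x` and `F₂ x` together, so `x` has to be dropped for the image
    -- to lie in both `U₁` and `U₂`.
    D : Subset m
    D = (A₁ ∩ A₂) - x

    D⊆∩ : D ⊆ A₁ ∩ A₂
    D⊆∩ = p─q⊆p _ _

    inter⊆ : image F D ⊆ U₁ ∩ U₂
    inter⊆ y∈ with ∈-image⁻ {F = F} y∈
    ... | z , z∈D , y∈Fz = x∈p∩q⁺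
      ( ∈-image⁺ (proj₁ (x∈p∩q⁻ _ _ (D⊆∩ z∈D))) (F⊆F₁ z≢x y∈Fz)
      , ∈-image⁺ (proj₂ (x∈p∩q⁻ _ _ (D⊆∩ z∈D))) (F⊆F₂ z≢x y∈Fz))
      where
      z≢x : z ≢ x
      z≢x refl = x∈p─q⇒x∉q (A₁ ∩ A₂) ⁅ x ⁆ z∈D (x∈⁅x⁆ x)

    bound : ∣ A₁ ∣ + ∣ A₂ ∣ ≤ suc (∣ U₁ ∣ + ∣ U₂ ∣)
    bound = begin
      ∣ A₁ ∣ + ∣ A₂ ∣                    ≡⟨ ∣p∪q∣+∣p∩q∣≡∣p∣+∣q∣ A₁ A₂ ⟨
      ∣ A₁ ∪ A₂ ∣ + ∣ A₁ ∩ A₂ ∣          ≤⟨ +-monoʳ-≤ _ (∣p∣≤1+∣p-x∣ (A₁ ∩ A₂) x) ⟩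
      ∣ A₁ ∪ A₂ ∣ + suc ∣ D ∣            ≡⟨ +-suc _ _ ⟩
      suc (∣ A₁ ∪ A₂ ∣ + ∣ D ∣)          ≤⟨ s≤s (+-mono-≤
                                              (≤-trans (hall (A₁ ∪ A₂) λ z∈ → [ A₁⊆S , A₂⊆S ]′ (x∈p∪q⁻ _ _ z∈))
                                                (p⊆q⇒∣p∣≤∣q∣ union⊆))
                                              (≤-trans (hall D (A₁⊆S ∘ proj₁ ∘ x∈p∩q⁻ _ _ ∘ D⊆∩))
                                                (p⊆q⇒∣p∣≤∣q∣ inter⊆))) ⟩
      suc (∣ U₁ ∪ U₂ ∣ + ∣ U₁ ∩ U₂ ∣)    ≡⟨ cong suc (∣p∪q∣+∣p∩q∣≡∣p∣+∣q∣ U₁ U₂) ⟩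
      suc (∣ U₁ ∣ + ∣ U₂ ∣)              ∎
      where open ≤-Reasoning

    -- Two strict violations gain two, which beats the one lost by dropping `x` from the
    -- intersection.
    gap : suc (∣ U₁ ∣ + ∣ U₂ ∣) < ∣ A₁ ∣ + ∣ A₂ ∣
    gap = ≤-trans (≤-reflexive (cong suc (sym (+-suc ∣ U₁ ∣ ∣ U₂ ∣)))) (+-mono-≤ lt₁ lt₂)

  -- Shrinking a family to singletons, one index at a time

  _[_↦_] : (Fin m → Subset n) → Fin m → Subset n → Fin m → Subset n
  F [ x ↦ p ] = updateAt F x (const p)

  [↦]-elsewhere : (F : Fin m → Subset n) {x z : Fin m} {p q : Subset n} →
    z ≢ x → (F [ x ↦ p ]) z ⊆ (F [ x ↦ q ]) z
  [↦]-elsewhere F {x} {z} z≢x = subst (_ ∈_)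
    (trans (updateAt-minimal z x F z≢x) (sym (updateAt-minimal z x F z≢x)))

  [↦]-∪ : (F : Fin m → Subset n) (x : Fin m) {p q r : Subset n} →
    p ⊆ q ∪ r → (F [ x ↦ p ]) x ⊆ (F [ x ↦ q ]) x ∪ (F [ x ↦ r ]) x
  [↦]-∪ F x {p} {q} {r} p⊆q∪r
    rewrite updateAt-updates x {const p} F | updateAt-updates x {const q} F
          | updateAt-updates x {const r} F = p⊆q∪r

  [↦]-expand : (F : Fin m → Subset n) (x : Fin m) {p : Subset n} →
    F x ⊆ p → ∀ z → F z ⊆ (F [ x ↦ p ]) z
  [↦]-expand F x Fx⊆p z with z ≟ x
  ... | yes refl = subst (_ ∈_) (sym (updateAt-updates x F)) ∘ Fx⊆p
  ... | no z≢x = subst (_ ∈_) (sym (updateAt-minimal z x F z≢x))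

  [↦]-shrink : (F : Fin m → Subset n) (x : Fin m) {p : Subset n} →
    p ⊆ F x → ∀ z → (F [ x ↦ p ]) z ⊆ F z
  [↦]-shrink F x p⊆Fx z with z ≟ x
  ... | yes refl = p⊆Fx ∘ subst (_ ∈_) (updateAt-updates x F)
  ... | no z≢x = subst (_ ∈_) (updateAt-minimal z x F z≢x)

  hallOn-⊆ : {F F′ : Fin m → Subset n} → (∀ z → F z ⊆ F′ z) → HallOn S F → HallOn S F′
  hallOn-⊆ {F = F} {F′} F⊆F′ hall A A⊆S = ≤-trans (hall A A⊆S) (p⊆q⇒∣p∣≤∣q∣ image⊆)
    where
    image⊆ : image F A ⊆ image F′ A
    image⊆ y∈ with ∈-image⁻ {F = F} y∈
    ... | z , z∈A , y∈Fz = ∈-image⁺ z∈A (F⊆F′ z y∈Fz)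

  -- Hall's condition at the index `x` alone yields a point `y` of `p`. By `hall-split` the
  -- condition survives either for `⁅ y ⁆` or for `p - y`, and in the second case the search
  -- continues in the smaller set.
  hall-singleton : (F : Fin m → Subset n) {x : Fin m} → x ∈ S →
    ∀ {p} → Acc _⊂_ p → HallOn S (F [ x ↦ p ]) →
    ∃ λ y → y ∈ p × HallOn S (F [ x ↦ ⁅ y ⁆ ])
  hall-singleton F {x} x∈S {p} (acc rs) hall with hall⇒nonempty hall x∈S
  ... | y , y∈ with subst (y ∈_) (updateAt-updates x F) y∈
  ... | y∈p with hall-split ([↦]-elsewhere F) ([↦]-elsewhere F)
                   ([↦]-∪ F x (p⊆q∪[p─q] p ⁅ y ⁆)) hall
  ... | inj₁ hall₁ = y , y∈p , hall₁
  ... | inj₂ hall₂ with hall-singleton F x∈S (rs (x∈p⇒p-x⊂p y∈p)) hall₂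
  ... | z , z∈ , hall-z = z , p─q⊆p p ⁅ y ⁆ z∈ , hall-z

  hall-step : (F : Fin m → Subset n) → HallOn S F → ∀ {x} → x ∈ S →
    ∃ λ F′ → (∀ z → F′ z ⊆ F z) × HallOn S F′ × ∃ λ y → F′ x ⊆ ⁅ y ⁆
  hall-step F hall {x} x∈S
    with hall-singleton F x∈S (⊂-wellFounded (F x)) (hallOn-⊆ ([↦]-expand F x id) hall)
  ... | y , y∈Fx , hall′ = F [ x ↦ ⁅ y ⁆ ] , [↦]-shrink F x (⁅⁆⊆ y∈Fx) , hall′ , y ,
    subst (_ ∈_) (updateAt-updates x F)

  -- The conclusion asks for inclusion in a singleton because inclusion survives further shrinking:
  -- indices treated earlier stay settled.
  hall-singletons : (F : Fin m → Subset n) → HallOn S F → (xs : List (Fin m)) →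
    ∃ λ F′ → (∀ z → F′ z ⊆ F z) × HallOn S F′ ×
      (∀ {x} → x ∈ˡ xs → x ∈ S → ∃ λ y → F′ x ⊆ ⁅ y ⁆)
  hall-singletons F hall [] = F , (λ _ → id) , hall , λ ()
  hall-singletons F hall (x ∷ xs) with hall-singletons F hall xs
  ... | F₁ , F₁⊆F , hall₁ , single₁ with x ∈? S
  ... | no x∉S = F₁ , F₁⊆F , hall₁ , λ where
    (here refl) x∈S → contradiction x∈S x∉S
    (there x∈xs) → single₁ x∈xs
  ... | yes x∈S with hall-step F₁ hall₁ x∈S
  ... | F₂ , F₂⊆F₁ , hall₂ , single-x = F₂ , (λ z → F₁⊆F z ∘ F₂⊆F₁ z) , hall₂ , λ where
    (here refl) _ → single-x
    (there x∈xs) x∈S → let y , F₁x⊆y = single₁ x∈xs x∈S in y , F₁x⊆y ∘ F₂⊆F₁ _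

-- Domain and codomain coincide only so that the transversal has a value outside S.
hall : (S : Subset n) (F : Fin n → Subset n) → HallOn S F →
  ∃ λ (f : Fin n → Fin n) → (∀ {x} → x ∈ S → f x ∈ F x) × InjectiveOn S f
hall {n} S F hallF with hall-singletons F hallF (allFin n)
... | F′ , F′⊆F , hall′ , single = f , f∈F , f-injective
  where
  choice : ∀ x → ∃ λ y → x ∈ S → y ∈ F′ x × F′ x ⊆ ⁅ y ⁆
  choice x with x ∈? S
  ... | no x∉S = x , λ x∈S → contradiction x∈S x∉S
  ... | yes x∈S with hall⇒nonempty hall′ x∈S | single (∈-allFin x) x∈S
  ... | z , z∈ | y , ⊆y with x∈⁅y⁆⇒x≡y y (⊆y z∈)
  ... | refl = y , λ _ → z∈ , ⊆y
  f : Fin n → Fin n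
  f = proj₁ ∘ choice
  f∈F : ∀ {x} → x ∈ S → f x ∈ F x
  f∈F {x} x∈S = F′⊆F x (proj₁ (proj₂ (choice x) x∈S))
  f-injective : InjectiveOn S f
  f-injective {x} {y} x∈S y∈S fx≡fy with x ≟ y
  ... | yes x≡y = x≡y
  -- Two indices with the same value would form a pair whose image has at most one point, against
  -- Hall's condition.
  ... | no x≢y = contradiction
    (subst₂ _≤_ (∣⁅x&y⁆∣≡2 x≢y) (∣⁅x⁆∣≡1 (f x))
      (≤-trans (hall′ ⁅ x & y ⁆ (⁅x&y⁆⊆ x∈S y∈S)) (p⊆q⇒∣p∣≤∣q∣ image⊆)))
    λ { (s≤s ()) }
    where
    image⊆ : image F′ ⁅ x & y ⁆ ⊆ ⁅ f x ⁆
    image⊆ w∈ with ∈-image⁻ {F = F′} w∈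
    ... | z , z∈ , w∈F′z with x∈⁅y&z⁆⁻ x y z∈
    ... | inj₁ refl = proj₂ (proj₂ (choice x) x∈S) w∈F′z
    ... | inj₂ refl = subst (λ u → _ ∈ ⁅ u ⁆) (sym fx≡fy)
                        (proj₂ (proj₂ (choice y) y∈S) w∈F′z)

-- Independent sets

module _ (G : Graph n) where
  open Graph G renaming (sym to adj-sym)

  adjacent⇒≢ : ∀ {u v} → Adj u v → u ≢ v
  adjacent⇒≢ uv u≡v = irrefl u≡v uv

  neighbours : Fin n → Subset n
  neighbours v = comprehension (adj? v)

  N : Subset n → Subset n
  N = image neighbours

  ∈-N⁺ : ∀ {A u v} → u ∈ A → Adj u v → v ∈ N A
  ∈-N⁺ u∈A uv = ∈-image⁺ u∈A (∈-comprehension⁺ (adj? _) uv)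

  ∈-N⁻ : ∀ {A v} → v ∈ N A → ∃ λ u → u ∈ A × Adj u v
  ∈-N⁻ v∈ with ∈-image⁻ {F = neighbours} v∈
  ... | u , u∈A , v∈Nu = u , u∈A , ∈-comprehension⁻ (adj? u) v∈Nu

  independent-⊆ : ∀ {A B} → A ⊆ B → Independent G B → Independent G A
  independent-⊆ A⊆B ind u v u∈A v∈A = ind u v (A⊆B u∈A) (A⊆B v∈A)

  independent-⁅⁆ : ∀ v → Independent G ⁅ v ⁆
  independent-⁅⁆ v u w u∈ w∈ =
    irrefl (trans (x∈⁅y⁆⇒x≡y v u∈) (sym (x∈⁅y⁆⇒x≡y v w∈)))

  independent-∪ : ∀ {A B} → Independent G A → Independent G B →
    (∀ {u v} → u ∈ A → v ∈ B → ¬ Adj u v) → Independent G (A ∪ B)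
  independent-∪ {A} {B} indA indB cross u v u∈ v∈ uv
    with x∈p∪q⁻ A B u∈ | x∈p∪q⁻ A B v∈
  ... | inj₁ u∈A | inj₁ v∈A = indA u v u∈A v∈A uv
  ... | inj₁ u∈A | inj₂ v∈B = cross u∈A v∈B uv
  ... | inj₂ u∈B | inj₁ v∈A = cross v∈A u∈B (adj-sym uv)
  ... | inj₂ u∈B | inj₂ v∈B = indB u v u∈B v∈B uv

  -- Maximality within `U` is encoded as domination, the form in which the exchange argument uses
  -- it.
  MaximalIndependentIn : Subset n → Subset n → Set
  MaximalIndependentIn U J =
    Independent G J × J ⊆ U × (∀ {v} → v ∈ U → v ∉ J → v ∈ N J)

  -- Greedy extension: undominated vertices of `U` are added one by one, and the strict growth of
  -- the set gives termination.
  extend-in : ∀ U I → Independent G I → I ⊆ U →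
    ∃ λ J → I ⊆ J × MaximalIndependentIn U J
  extend-in U I = go I (⊃-wellFounded I)
    where
    go : ∀ I → Acc _⊃_ I → Independent G I → I ⊆ U →
      ∃ λ J → I ⊆ J × MaximalIndependentIn U J
    go I (acc rs) ind I⊆U
      with any? (λ v → (v ∈? U) ×-dec (¬? (v ∈? I)) ×-dec (¬? (v ∈? N I)))
    ... | no none = I , id , ind , I⊆U , dominated
      where
      dominated : ∀ {v} → v ∈ U → v ∉ I → v ∈ N I
      dominated {v} v∈U v∉I with v ∈? N I
      ... | yes v∈N = v∈N
      ... | no v∉N = contradiction (v , v∈U , v∉I , v∉N) none
    ... | yes (v , v∈U , v∉I , v∉N)
      with go (I ∪ ⁅ v ⁆)
        (rs (p⊆p∪q _ , v , q⊆p∪q I ⁅ v ⁆ (x∈⁅x⁆ v) , v∉I))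
        (independent-∪ ind (independent-⁅⁆ v) λ u∈I w∈v uw →
          v∉N (∈-N⁺ u∈I (subst (Adj _) (x∈⁅y⁆⇒x≡y v w∈v) uw)))
        (λ w∈ → [ I⊆U , ⁅⁆⊆ v∈U ]′ (x∈p∪q⁻ I ⁅ v ⁆ w∈))
    ... | J , I∪v⊆J , maximal = J , I∪v⊆J ∘ p⊆p∪q _ , maximal

  -- With `U` the whole vertex set, domination implies maximality under inclusion: a further vertex
  -- of an independent superset would be adjacent to `J`.
  extend : ∀ I → Independent G I → ∃ λ J → I ⊆ J × MaximalIndependent G J
  extend I ind with extend-in ⊤ I ind (λ _ → ∈⊤)
  ... | J , I⊆J , indJ , _ , dominated = J , I⊆J , indJ , maximal
    where
    maximal : ∀ T → Independent G T → J ⊆ T → T ⊆ J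
    maximal T indT J⊆T {v} v∈T with v ∈? J
    ... | yes v∈J = v∈J
    ... | no v∉J with ∈-N⁻ (dominated ∈⊤ v∉J)
    ... | u , u∈J , uv = contradiction uv (indT u v (J⊆T u∈J) v∈T)

  -- Berge's inequality for well-covered graphs

  module _ (wellCovered : WellCovered G) where

    ∣independent∣≤∣maximal∣ : ∀ {I X} → Independent G I → MaximalIndependent G X →
      ∣ I ∣ ≤ ∣ X ∣
    ∣independent∣≤∣maximal∣ {I} {X} ind maxX with extend I ind
    ... | J , I⊆J , maxJ =
      ≤-trans (p⊆q⇒∣p∣≤∣q∣ I⊆J) (≤-reflexive (wellCovered J X maxJ maxX))

    ∣maximal∣≡α : ∀ {X} → MaximalIndependent G X → ∣ X ∣ ≡ α G
    ∣maximal∣≡α {X} maxX with independenceNumber-exists G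
    ... | a , (S , indS , ∣S∣≡a) , upper =
      ≤-antisym (upper X (proj₁ maxX))
        (≤-trans (≤-reflexive (sym ∣S∣≡a)) (∣independent∣≤∣maximal∣ indS maxX))

    ∣A∩N[B]∣≤∣B∣ : ∀ {A B} → Independent G A → MaximalIndependentIn (N A) B →
      ∣ A ∩ N B ∣ ≤ ∣ B ∣
    ∣A∩N[B]∣≤∣B∣ {A} {B} indA (indB , _ , dominated) with extend B indB
    ... | I , B⊆I , maxI@(indI , _) = +-cancelˡ-≤ ∣ I ─ B ∣ _ _ (begin
      ∣ I ─ B ∣ + ∣ A ∩ N B ∣    ≡⟨ disjoint⇒∣p∪q∣≡∣p∣+∣q∣ _ _ disjoint ⟨
      ∣ (I ─ B) ∪ (A ∩ N B) ∣    ≤⟨ ∣independent∣≤∣maximal∣ indK maxI ⟩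
      ∣ I ∣                      ≤⟨ ∣p∣≤∣q∣+∣p─q∣ I B ⟩
      ∣ B ∣ + ∣ I ─ B ∣          ≡⟨ +-comm ∣ B ∣ _ ⟩
      ∣ I ─ B ∣ + ∣ B ∣          ∎)
      where
      open ≤-Reasoning
      I∩N[B]-empty : ∀ {v} → v ∈ I → v ∉ N B
      I∩N[B]-empty {v} v∈I v∈N with ∈-N⁻ v∈N
      ... | b , b∈B , bv = indI b v (B⊆I b∈B) v∈I bv
      disjoint : ∀ {v} → v ∈ I ─ B → v ∉ A ∩ N B
      disjoint v∈ v∈′ = I∩N[B]-empty (p─q⊆p I B v∈) (proj₂ (x∈p∩q⁻ A (N B) v∈′))
      indK : Independent G ((I ─ B) ∪ (A ∩ N B))
      indK = independent-∪
        (independent-⊆ (p─q⊆p I B) indI)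
        (independent-⊆ (proj₁ ∘ x∈p∩q⁻ A (N B)) indA)
        -- A vertex of `I ─ B` adjacent to `A` lies in `N A` outside `B`, hence is dominated by `B`.
        -- This contradicts the independence of `I`, which contains `B`.
        λ i∈ a∈ ia → I∩N[B]-empty (p─q⊆p I B i∈)
          (dominated (∈-N⁺ (proj₁ (x∈p∩q⁻ A (N B) a∈)) (adj-sym ia)) (x∈p─q⇒x∉q I B i∈))

    berge : NoIsolatedVertices G → ∀ A → Independent G A → ∣ A ∣ ≤ ∣ N A ∣
    berge noIsolated A = go A (⊂-wellFounded A)
      where
      go : ∀ A → Acc _⊂_ A → Independent G A → ∣ A ∣ ≤ ∣ N A ∣
      go A (acc rs) ind with nonempty? A
      ... | no ¬ne = ≤-trans
        (≤-reflexive (trans (cong ∣_∣ (Empty-unique ¬ne)) (∣⊥∣≡0 n))) z≤n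
      ... | yes (a , a∈A) with noIsolated a
      -- Growing `B` from a neighbour `b` of `a` puts `a` into `N B`, so that `A ─ N B` is strictly
      -- smaller than `A`.
      ... | b , ab with extend-in (N A) ⁅ b ⁆ (independent-⁅⁆ b) (⁅⁆⊆ (∈-N⁺ a∈A ab))
      ... | B , b⊆B , maxB@(_ , B⊆NA , _) = begin
        ∣ A ∣                           ≤⟨ ∣p∣≤∣p∩q∣+∣p─q∣ A (N B) ⟩
        ∣ A ∩ N B ∣ + ∣ A ─ N B ∣       ≤⟨ +-mono-≤ (∣A∩N[B]∣≤∣B∣ ind maxB)
                                             (go (A ─ N B) (rs smaller) (independent-⊆ (p─q⊆p A (N B)) ind)) ⟩
        ∣ B ∣ + ∣ N (A ─ N B) ∣         ≡⟨ disjoint⇒∣p∪q∣≡∣p∣+∣q∣ B _ disjoint ⟨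
        ∣ B ∪ N (A ─ N B) ∣             ≤⟨ p⊆q⇒∣p∣≤∣q∣ (λ v∈ → [ B⊆NA , N⊆ ]′ (x∈p∪q⁻ B _ v∈)) ⟩
        ∣ N A ∣                         ∎
        where
        open ≤-Reasoning
        smaller : A ─ N B ⊂ A
        smaller = p∩q≢∅⇒p─q⊂p A (N B)
          (a , x∈p∩q⁺ (a∈A , ∈-N⁺ (b⊆B (x∈⁅x⁆ b)) (adj-sym ab)))
        -- A neighbour in `A` of a vertex of `B` lies in `N B`, and these have been removed.
        disjoint : ∀ {v} → v ∈ B → v ∉ N (A ─ N B)
        disjoint v∈B v∈N with ∈-N⁻ v∈N
        ... | u , u∈ , uv = x∈p─q⇒x∉q A (N B) u∈ (∈-N⁺ v∈B (adj-sym uv))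
        N⊆ : N (A ─ N B) ⊆ N A
        N⊆ v∈N with ∈-N⁻ v∈N
        ... | u , u∈ , uv = ∈-N⁺ (p─q⊆p A (N B) u∈) uv

  -- Perfect matchings

  edge-clique : ∀ {e} → Edge G e → Clique G e
  edge-clique (u , v , uv , refl) x y x∈ y∈ x≢y with x∈⁅y&z⁆⁻ u v x∈ | x∈⁅y&z⁆⁻ u v y∈
  ... | inj₁ refl | inj₁ refl = contradiction refl x≢y
  ... | inj₁ refl | inj₂ refl = uv
  ... | inj₂ refl | inj₁ refl = adj-sym uv
  ... | inj₂ refl | inj₂ refl = contradiction refl x≢y

  module _ {M : Pred (Subset n) 0ℓ} (matching : PerfectMatching G M) where
    open PerfectMatching matching

    matched : ∀ v → ∃ λ w → Adj v w × M ⁅ v & w ⁆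
    matched v with covers v
    ... | e , Me , v∈e with edges e Me
    ... | x , y , xy , refl with x∈⁅y&z⁆⁻ x y v∈e
    ... | inj₁ refl = y , xy , Me
    ... | inj₂ refl = x , adj-sym xy , subst M (∪-comm ⁅ x ⁆ ⁅ y ⁆) Me

    partner : Fin n → Fin n
    partner = proj₁ ∘ matched

    adj-partner : ∀ v → Adj v (partner v)
    adj-partner = proj₁ ∘ proj₂ ∘ matched

    M-partner : ∀ v → M ⁅ v & partner v ⁆
    M-partner = proj₂ ∘ proj₂ ∘ matched

    -- The edges at `v` and `w` share the vertex `partner v`, so they coincide and `v` is `w` or
    -- `partner w`. The latter equals `partner v`, which is adjacent to `v` and hence different from
    -- it.
    partner-injective : ∀ {v w} → partner v ≡ partner w → v ≡ w
    partner-injective {v} {w} pv≡pw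
      with x∈⁅y&z⁆⁻ w (partner w)
        (subst (v ∈_)
          (disjoint _ _ (M-partner v) (M-partner w) (partner v) (y∈⁅x&y⁆ v _)
            (subst (_∈ ⁅ w & partner w ⁆) (sym pv≡pw) (y∈⁅x&y⁆ w _)))
          (x∈⁅x&y⁆ v _))
    ... | inj₁ v≡w = v≡w
    ... | inj₂ v≡pw = contradiction (trans v≡pw (sym pv≡pw)) (adjacent⇒≢ (adj-partner v))

    partner∈∁ : ∀ {X} → Independent G X → ∀ {v} → v ∈ X → partner v ∈ ∁ X
    partner∈∁ ind {v} v∈X = x∉p⇒x∈∁p λ pv∈X → ind v (partner v) v∈X pv∈X (adj-partner v)

    -- By equal sizes `partner` maps `X` onto `∁ X`. An endpoint of `e` outside `X` is thus the
    -- partner of some `x` in `X`, and disjointness of the matching forces `x` into `e`.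
    half⇒strong : (∀ X → MaximalIndependent G X → ∣ ∁ X ∣ ≡ ∣ X ∣) →
      ∀ e → M e → StrongClique G e
    half⇒strong half e Me = edge-clique (edges e Me) , meets
      where
      meets : ∀ X → MaximalIndependent G X → Nonempty (e ∩ X)
      meets X maxX@(ind , _) with edges e Me
      ... | u , v , uv , refl with u ∈? X
      ... | yes u∈X = u , x∈p∩q⁺ (x∈⁅x&y⁆ u v , u∈X)
      ... | no u∉X
        with injectiveOn⇒surjectiveOn X (∁ X) partner (partner∈∁ ind)
          (λ _ _ → partner-injective) (≤-reflexive (half X maxX)) (x∉p⇒x∈∁p u∉X)
      ... | x , x∈X , refl = x , x∈p∩q⁺
        ( subst (x ∈_)
            (disjoint _ _ (M-partner x) Me u (y∈⁅x&y⁆ x u) (x∈⁅x&y⁆ u v))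
            (x∈⁅x&y⁆ x u)
        , x∈X)

    -- An edge that meets `X` at a vertex other than `v` meets it at `partner v`, so strength makes
    -- `partner` an injection from `∁ X` to `X` as well as back.
    strong⇒half : (∀ e → M e → StrongClique G e) →
      ∀ X → MaximalIndependent G X → ∣ ∁ X ∣ ≡ ∣ X ∣
    strong⇒half strong X maxX@(ind , _) = ≤-antisym
      (injectiveOn⇒∣p∣≤∣q∣ (∁ X) X partner partner∈ λ _ _ → partner-injective)
      (injectiveOn⇒∣p∣≤∣q∣ X (∁ X) partner (partner∈∁ ind) λ _ _ → partner-injective)
      where
      partner∈ : ∀ {v} → v ∈ ∁ X → partner v ∈ X
      partner∈ {v} v∈∁X with proj₂ (strong _ (M-partner v)) X maxX
      ... | w , w∈ with x∈p∩q⁻ ⁅ v & partner v ⁆ X w∈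
      ... | w∈e , w∈X with x∈⁅y&z⁆⁻ v (partner v) w∈e
      ... | inj₁ refl = contradiction w∈X (x∈∁p⇒x∉p v∈∁X)
      ... | inj₂ refl = w∈X

  -- Very well-covered graphs: every maximal independent set has half the vertices

  private
    2∣X∣≡n : ∀ X → ∣ ∁ X ∣ ≡ ∣ X ∣ → 2 * ∣ X ∣ ≡ n
    2∣X∣≡n X half = trans (cong (∣ X ∣ +_) (trans (+-identityʳ _) (sym half))) (∣p∣+∣∁p∣≡n X)

  veryWellCovered⇒half : VeryWellCovered G → ∀ X → MaximalIndependent G X → ∣ ∁ X ∣ ≡ ∣ X ∣
  veryWellCovered⇒half (wc , _ , 2α≡n) X maxX =
    +-cancelˡ-≡ ∣ X ∣ _ _ (trans (∣p∣+∣∁p∣≡n X) (trans (sym 2α≡n)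
      (trans (cong (2 *_) (sym (∣maximal∣≡α wc maxX))) (cong (∣ X ∣ +_) (+-identityʳ _)))))

  half⇒veryWellCovered : NoIsolatedVertices G →
    (∀ X → MaximalIndependent G X → ∣ ∁ X ∣ ≡ ∣ X ∣) → VeryWellCovered G
  half⇒veryWellCovered noIsolated half = wc , noIsolated , 2α≡n
    where
    wc : WellCovered G
    wc S T maxS maxT = *-cancelˡ-≡ _ _ 2
      (trans (2∣X∣≡n S (half S maxS)) (sym (2∣X∣≡n T (half T maxT))))
    2α≡n : 2 * α G ≡ n
    -- Extending the empty set supplies a maximal independent set from which `α G` can be read off.
    2α≡n with extend ⊥ (λ _ _ u∈⊥ → contradiction u∈⊥ ∉⊥)
    ... | X , _ , maxX =
      trans (cong (2 *_) (sym (∣maximal∣≡α wc maxX))) (2∣X∣≡n X (half X maxX))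

  perfectMatching-exists : VeryWellCovered G →
    ∃ λ (M : Pred (Subset n) 0ℓ) → PerfectMatching G M
  perfectMatching-exists vwc@(wc , noIsolated , _)
    with extend ⊥ (λ _ _ u∈⊥ → contradiction u∈⊥ ∉⊥)
  ... | S , _ , maxS@(indS , _)
    -- `N A` is by definition the image of `A` under `neighbours`, so Berge's inequality on subsets
    -- of `S` is exactly Hall's condition.
    with hall S neighbours (λ A A⊆S → berge wc noIsolated A (independent-⊆ A⊆S indS))
  ... | f , f∈ , f-injective = M , record
    { edges    = λ { e (x , x∈S , eq) → x , f x , adj-f x∈S , eq }
    ; disjoint = disjoint
    ; covers   = covers
    }
    where
    adj-f : ∀ {x} → x ∈ S → Adj x (f x)
    adj-f x∈S = ∈-comprehension⁻ (adj? _) (f∈ x∈S)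
    f∈∁S : ∀ {x} → x ∈ S → f x ∈ ∁ S
    f∈∁S {x} x∈S = x∉p⇒x∈∁p λ fx∈S → indS x (f x) x∈S fx∈S (adj-f x∈S)
    -- Each edge is indexed by its endpoint in `S`; the other endpoint `f x` lies in `∁ S`, which
    -- rules out the mixed cases of disjointness.
    M : Pred (Subset n) 0ℓ
    M e = ∃ λ x → x ∈ S × e ≡ ⁅ x & f x ⁆
    disjoint : ∀ d e → M d → M e → ∀ v → v ∈ d → v ∈ e → d ≡ e
    disjoint d e (x , x∈S , refl) (y , y∈S , refl) v v∈d v∈e
      with x∈⁅y&z⁆⁻ x (f x) v∈d | x∈⁅y&z⁆⁻ y (f y) v∈e
    ... | inj₁ refl | inj₁ refl = refl
    ... | inj₁ refl | inj₂ refl = contradiction x∈S (x∈∁p⇒x∉p (f∈∁S y∈S))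
    ... | inj₂ refl | inj₁ refl = contradiction y∈S (x∈∁p⇒x∉p (f∈∁S x∈S))
    ... | inj₂ v≡fx | inj₂ v≡fy =
      cong (λ z → ⁅ z & f z ⁆) (f-injective x∈S y∈S (trans (sym v≡fx) v≡fy))
    covers : ∀ v → ∃ λ e → M e × v ∈ e
    covers v with v ∈? S
    ... | yes v∈S = ⁅ v & f v ⁆ , (v , v∈S , refl) , x∈⁅x&y⁆ v _
    ... | no v∉S
      -- Since `S` and `∁ S` have equal size, the injection `f` reaches every vertex outside `S`.
      with injectiveOn⇒surjectiveOn S (∁ S) f f∈∁S f-injective
        (≤-reflexive (veryWellCovered⇒half vwc S maxS)) (x∉p⇒x∈∁p v∉S)
    ... | x , x∈S , refl = ⁅ x & f x ⁆ , (x , x∈S , refl) , y∈⁅x&y⁆ x _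

  -- Implications between the four conditions

  veryWellCovered⇒allStrong : VeryWellCovered G → HasPerfectMatchingAndAllStrong G
  veryWellCovered⇒allStrong vwc =
    perfectMatching-exists vwc , λ M pm → half⇒strong pm (veryWellCovered⇒half vwc)

  allStrong⇒strongPerfectMatching :
    HasPerfectMatchingAndAllStrong G → HasStrongPerfectMatching G
  allStrong⇒strongPerfectMatching ((M , pm) , strong) = M , pm , strong M pm

  strongPerfectMatching⇒veryWellCovered :
    NoIsolatedVertices G → HasStrongPerfectMatching G → VeryWellCovered G
  strongPerfectMatching⇒veryWellCovered noIsolated (M , pm , strong) =
    half⇒veryWellCovered noIsolated (strong⇒half pm strong)

  strongPerfectMatching⇒strongPairPartition :
    HasStrongPerfectMatching G → HasStrongPairPartition G
  strongPerfectMatching⇒strongPairPartition (M , pm , strong) = M , partition , pairs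
    where
    open PerfectMatching pm
    partition : Partition M
    partition = record
      { nonempty = λ e Me → let u , v , _ , e≡ = edges e Me in
                   u , subst (u ∈_) (sym e≡) (x∈⁅x&y⁆ u v)
      ; disjoint = disjoint
      ; covers   = covers
      }
    pairs : ∀ e → M e → StrongClique G e × ∣ e ∣ ≡ 2
    pairs e Me with edges e Me
    ... | u , v , uv , refl = strong e Me , ∣⁅x&y⁆∣≡2 (adjacent⇒≢ uv)

  -- A clique with two vertices is an edge, so the same family serves as the matching.
  strongPairPartition⇒strongPerfectMatching :
    HasStrongPairPartition G → HasStrongPerfectMatching G
  strongPairPartition⇒strongPerfectMatching (P , partition , strong) =
    P , record { edges = edges ; disjoint = disjoint ; covers = covers } ,
    λ C → proj₁ ∘ strong C
    where
    open Partition partition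
    edges : ∀ C → P C → Edge G C
    edges C PC with strong C PC
    ... | (clique , _) , ∣C∣≡2 with ∣p∣≡2⇒pair C ∣C∣≡2
    ... | x , y , x≢y , refl = x , y , clique x y (x∈⁅x&y⁆ x y) (y∈⁅x&y⁆ x y) x≢y , refl

  veryWellCovered⇒strongPairPartition : VeryWellCovered G → HasStrongPairPartition G
  veryWellCovered⇒strongPairPartition =
    strongPerfectMatching⇒strongPairPartition ∘ allStrong⇒strongPerfectMatching ∘
    veryWellCovered⇒allStrong

mainTheorem5 : ∀ (n : ℕ) (G : Graph n) →
    (NoIsolatedVertices G →
    (VeryWellCovered G ⇔ HasStrongPerfectMatching G) ×
    (VeryWellCovered G ⇔ HasPerfectMatchingAndAllStrong G) ×
    (VeryWellCovered G ⇔ HasStrongPairPartition G)) ×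
    (VeryWellCovered G → Localizable G)
mainTheorem5 n G =
  (λ noIsolated →
    let 2⇒1 = strongPerfectMatching⇒veryWellCovered G noIsolated in
    mk⇔ (allStrong⇒strongPerfectMatching G ∘ veryWellCovered⇒allStrong G) 2⇒1 ,
    mk⇔ (veryWellCovered⇒allStrong G) (2⇒1 ∘ allStrong⇒strongPerfectMatching G) ,
    mk⇔ (veryWellCovered⇒strongPairPartition G)
        (2⇒1 ∘ strongPairPartition⇒strongPerfectMatching G)) ,
  λ vwc → let P , partition , strong = veryWellCovered⇒strongPairPartition G vwc in
    P , partition , λ C → proj₁ ∘ strong C
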